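{- Let $b\ge 2$ be even and $n\ge 2$, and put $c_i=b^{n+i}+1$. Then $$\mathrm{Ap}(SC^{+}(b,n),c_0)=\Big\{\sum_{i=1}^{n} t_i c_i : (t_1,\dots,t_n)\in RC_b(n)\Big\}.$$
   Context: For an even integer $b\ge2$ and $n\ge0$, $SC^{+}(b,n)=\langle\{b^{n+i}+1: i\in\mathbb{N}\}\rangle$ (submonoid of $(\mathbb{N},+)$ generated by these numbers). $\mathrm{Ap}(S,x)=\{s\in S:s-x\notin S\}$. $RC_b(n)$ is the set of $(t_1,\dots,t_n)\in\{0,1,\dots,b\}^n$ such that: (i) if $t_i=b$ then $t_j=0$ for all $1\le j<i$; (ii) $t_n\le b-1$; (iii) if $t_n=b-1$ then $t_1\le 1$ and $t_i=0$ for all $i\notin\{1,n\}$. -}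

module Defs where

open import Algebra.Properties.CommutativeMonoid.Sum using (sum)
open import Data.Fin using (Fin; toℕ)
open import Data.Integer as ℤ using (+_)
open import Data.Nat using (ℕ; suc; _+_; _*_; _∸_; _^_; _≤_; _<_)
open import Data.Nat.Properties using (+-0-commutativeMonoid)
open import Data.Product using (_×_; ∃-syntax)
open import Data.Vec.Functional using (Vector)
open import Level using (0ℓ)
open import Relation.Binary.PropositionalEquality using (_≡_; _≢_)
open import Relation.Nullary using (¬_)
open import Relation.Unary using (Pred; _∈_)

data ⟨_⟩ (A : Pred ℕ 0ℓ) : Pred ℕ 0ℓ where
  gen  : ∀ {x} → x ∈ A → x ∈ ⟨ A ⟩
  zero : 0 ∈ ⟨ A ⟩
  add  : ∀ {x y} → x ∈ ⟨ A ⟩ → y ∈ ⟨ A ⟩ → x + y ∈ ⟨ A ⟩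

c : (b n i : ℕ) → ℕ
c b n i = b ^ (n + i) + 1

SC⁺ : (b n : ℕ) → Pred ℕ 0ℓ
SC⁺ b n = ⟨ (λ x → ∃[ i ] x ≡ c b n i) ⟩

-- The difference s - x is taken in ℤ, so every s ∈ S with s < x belongs to Ap S x.
Ap : Pred ℕ 0ℓ → ℕ → Pred ℕ 0ℓ
Ap S x s = s ∈ S × ¬ (∃[ u ] u ∈ S × + s ℤ.- + x ≡ + u)

-- The coordinates t₁, …, tₙ are indexed by Fin n; ix recovers the 1-based index.
ix : ∀ {n} → Fin n → ℕ
ix i = suc (toℕ i)

-- In last-≤ and last-≡, l is the position of the last coordinate tₙ.
record RC (b n : ℕ) (t : Vector (Fin (suc b)) n) : Set where
  field
    zero-before : ∀ i → toℕ (t i) ≡ b → ∀ j → ix j < ix i → toℕ (t j) ≡ 0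
    last-≤      : ∀ l → ix l ≡ n → toℕ (t l) ≤ b ∸ 1
    last-≡      : ∀ l → ix l ≡ n → toℕ (t l) ≡ b ∸ 1 →
                  (∀ i → ix i ≡ 1 → toℕ (t i) ≤ 1) ×
                  (∀ i → ix i ≢ 1 → ix i ≢ n → toℕ (t i) ≡ 0)

RCSums : (b n : ℕ) → Pred ℕ 0ℓ
RCSums b n s =
  ∃[ t ] RC b n t × s ≡ sum +-0-commutativeMonoid (λ i → toℕ (t i) * c b n (ix i))

{-# OPTIONS --safe #-}
-- Write b = a + 1, B = bⁿ and let rᵢ = 1 + b + … + bⁱ⁻¹, so that bⁱ = 1 + a rᵢ.  A sum of
-- k generators equals B (k + a e) + k, where e is the sum of the corresponding rᵢ, and its
-- class modulo c₀ = B + 1 is determined by e modulo B + 1 (B a is invertible because b is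
-- even).  Conditions (i)–(iii) describe the greedy expansions Σ tᵢ rᵢ of the integers
-- 0, …, B.  A greedy expansion of e uses the fewest summands: a sum x of k powers of b
-- satisfies e ≤ ⌊x/b⌋ + ⌊x/b²⌋ + …, and this fails for every x smaller than Σ tᵢ bⁱ.
module Submission where

import Algebra.Properties.CommutativeSemigroup as CommutativeSemigroup
import Algebra.Properties.Semiring.Sum as SemiringSum
open import Data.Empty using (⊥; ⊥-elim)
open import Data.Fin using (Fin; zero; suc; toℕ; fromℕ; fromℕ<)
open import Data.Fin.Properties using (toℕ-fromℕ; toℕ-fromℕ<; toℕ-injective; toℕ≤pred[n])
import Data.Fin.Properties as Fin
open import Data.Integer as ℤ using () renaming (+_ to pos)
import Data.Integer.Properties as ℤ
open import Data.Nat using (ℕ; zero; suc; _+_; _*_; _^_; _⊔_; _≤_; _<_; z≤n; s≤s; s≤s⁻¹; NonZero; _≤?_)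
open import Data.Nat.Coprimality using (Coprime; coprime-divisor)
open import Data.Nat.DivMod using (_/_; _%_; m≡m%n+[m/n]*n; m%n<n; m*n/n≡m; m/n*n≤m; /-monoˡ-≤; m<n*o⇒m/o<n)
open import Data.Nat.Divisibility using (_∣_; divides; ∣-trans; ∣1⇒≡1; ∣m+n∣m⇒∣n; ∣m⇒∣m*n; m∣m*n; ∣⇒≤)
open import Data.Nat.Properties
open import Data.Nat.Tactic.RingSolver using (solve-∀)
open import Data.Product using (_×_; _,_; proj₁; proj₂; ∃-syntax)
open import Data.Sum using (_⊎_; inj₁; inj₂)
open import Data.Vec.Functional using (Vector; head; tail; _∷_)
open import Function using (_∘_)
open import Relation.Binary.PropositionalEquality using (_≡_; _≢_; _≗_; refl; sym; trans; cong; cong₂; subst; subst₂)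
open import Relation.Nullary using (¬_; yes; no; contradiction)
open import Relation.Unary using (_∈_; _≐_)
open import Defs

open CommutativeSemigroup *-commutativeSemigroup using () renaming (x∙yz≈y∙xz to *-swap)
open SemiringSum +-*-semiring using (sum; sum-cong-≗; ∑-distrib-+; *-distribˡ-sum; sum-replicate-zero)

-- Finite sums, integer differences and generated submonoids.

term≤sum : ∀ {n} (x : Vector ℕ n) i → x i ≤ sum x
term≤sum x zero    = m≤m+n _ _
term≤sum x (suc i) = ≤-trans (term≤sum (tail x) i) (m≤n+m _ _)

two-terms≤sum : ∀ {n} (x : Vector ℕ n) i j → i ≢ j → x i + x j ≤ sum x
two-terms≤sum x zero    zero    i≢j = contradiction refl i≢j
two-terms≤sum x zero    (suc j) i≢j = +-monoʳ-≤ (x zero) (term≤sum (tail x) j)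
two-terms≤sum x (suc i) zero    i≢j =
  subst (_≤ sum x) (+-comm (x zero) (x (suc i))) (+-monoʳ-≤ (x zero) (term≤sum (tail x) i))
two-terms≤sum x (suc i) (suc j) i≢j =
  ≤-trans (two-terms≤sum (tail x) i j (i≢j ∘ cong suc)) (m≤n+m _ _)

last-index : ∀ {m} (l : Fin (suc m)) → ix l ≡ suc m → l ≡ fromℕ m
last-index {m} l eq = toℕ-injective (trans (suc-injective eq) (sym (toℕ-fromℕ m)))

pos-difference : ∀ {s x u} → pos s ℤ.- pos x ≡ pos u → s ≡ u + x
pos-difference {s} {x} {u} eq = ℤ.+-injective (trans (sym cancel) (trans (cong (ℤ._+ pos x) eq) (sym (ℤ.pos-+ u x))))
  where
  cancel : (pos s ℤ.- pos x) ℤ.+ pos x ≡ pos s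
  cancel = trans (ℤ.+-assoc (pos s) (ℤ.- pos x) (pos x))
           (trans (cong (λ z → pos s ℤ.+ z) (ℤ.+-inverseˡ (pos x))) (ℤ.+-identityʳ (pos s)))

difference-pos : ∀ {s x u} → s ≡ u + x → pos s ℤ.- pos x ≡ pos u
difference-pos {_} {x} {u} refl = trans (cong (ℤ._- pos x) (ℤ.pos-+ u x))
  (trans (ℤ.+-assoc (pos u) (pos x) (ℤ.- pos x))
  (trans (cong (λ z → pos u ℤ.+ z) (ℤ.+-inverseʳ (pos x))) (ℤ.+-identityʳ (pos u))))

multiple-in : ∀ {A} k {x} → x ∈ ⟨ A ⟩ → k * x ∈ ⟨ A ⟩
multiple-in zero    x∈ = zero
multiple-in (suc k) x∈ = add x∈ (multiple-in k x∈)

sum-in : ∀ {A n} (x : Vector ℕ n) → (∀ i → x i ∈ ⟨ A ⟩) → sum x ∈ ⟨ A ⟩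
sum-in {n = zero}  x x∈ = zero
sum-in {n = suc n} x x∈ = add (x∈ zero) (sum-in (tail x) (x∈ ∘ suc))

-- Repunits and values in base `b`.

module Radix (a : ℕ) where

  b : ℕ
  b = suc a

  repunit : ℕ → ℕ
  repunit zero    = 0
  repunit (suc i) = b ^ i + repunit i

  pow≡1+a*repunit : ∀ i → b ^ i ≡ suc (a * repunit i)
  pow≡1+a*repunit zero    = cong suc (sym (*-zeroʳ a))
  pow≡1+a*repunit (suc i) = trans (cong (_+ a * b ^ i) (pow≡1+a*repunit i))
    (identity a (b ^ i) (repunit i))
    where
    identity : ∀ a p r → suc (a * r) + a * p ≡ suc (a * (p + r))
    identity = solve-∀

  value : ∀ {n} → Vector ℕ n → ℕ
  value t = sum (λ i → t i * b ^ toℕ i)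

  repunits : ∀ {n} → Vector ℕ n → ℕ
  repunits t = sum (λ i → t i * repunit (ix i))

  value-∷ : ∀ {n} (t : Vector ℕ (suc n)) → value t ≡ head t + b * value (tail t)
  value-∷ t = cong₂ _+_ (*-identityʳ (head t))
    (trans (sum-cong-≗ λ i → *-swap (tail t i) b (b ^ toℕ i))
           (sym (*-distribˡ-sum b (λ i → tail t i * b ^ toℕ i))))

  -- In the second sum the head carries the factor `repunit 0`, which is 0. Iterated, the recursion
  -- makes `repunits t` the sum of the values of `t` and its successive tails, the same shape as the
  -- sum of quotients in `floors`.
  repunits-∷ : ∀ {n} (t : Vector ℕ (suc n)) → repunits t ≡ value t + repunits (tail t)
  repunits-∷ t =
    trans (sum-cong-≗ λ i → *-distribˡ-+ (t i) (b ^ toℕ i) (repunit (toℕ i)))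
    (trans (∑-distrib-+ (λ i → t i * b ^ toℕ i) (λ i → t i * repunit (toℕ i)))
           (cong (λ z → value t + (z + repunits (tail t))) (*-zeroʳ (head t))))

  -- Each power `b ^ ix i` is `1 + a * repunit (ix i)`. For a fixed repunit sum, comparing numbers
  -- of summands thus becomes comparing values.
  b*value : ∀ {n} (t : Vector ℕ n) → b * value t ≡ sum t + a * repunits t
  b*value t =
    trans (*-distribˡ-sum b (λ i → t i * b ^ toℕ i))
    (trans (sum-cong-≗ λ i → trans (*-swap b (t i) (b ^ toℕ i))
             (trans (cong (t i *_) (pow≡1+a*repunit (ix i))) (expand a (t i) (repunit (ix i)))))
    (trans (∑-distrib-+ t (λ i → a * (t i * repunit (ix i))))
           (cong (sum t +_) (sym (*-distribˡ-sum a (λ i → t i * repunit (ix i)))))))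
    where
    expand : ∀ a x r → x * suc (a * r) ≡ x + a * (x * r)
    expand = solve-∀

  sum≤value : ∀ {n} (t : Vector ℕ n) → sum t ≤ value t
  sum≤value {zero}  t = z≤n
  sum≤value {suc n} t = subst (sum t ≤_) (sym (value-∷ t))
    (+-monoʳ-≤ (head t) (≤-trans (sum≤value (tail t)) (m≤n*m _ b)))

  -- Greedy expansions

  Digits : ∀ {n} → Vector ℕ n → Set
  Digits t = ∀ i → t i < b

  -- Condition (i) for vectors in which `b` does occur, recast as a recursion on the head so that
  -- carries and value bounds go by induction.
  LowestB : ∀ {n} → Vector ℕ n → Set
  LowestB {zero}  t = ⊥
  LowestB {suc n} t = (head t ≡ b × Digits (tail t)) ⊎ (head t ≡ 0 × LowestB (tail t))

  Greedy : ∀ {n} → Vector ℕ n → Set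
  Greedy t = Digits t ⊎ LowestB t

  cons-digits : ∀ {n} (t : Vector ℕ (suc n)) → head t < b → Digits (tail t) → Digits t
  cons-digits t h d zero    = h
  cons-digits t h d (suc i) = d i

  cons-zero : ∀ {n} (t : Vector ℕ (suc n)) → head t ≡ 0 → Greedy (tail t) → Greedy t
  cons-zero t h (inj₁ d) = inj₁ (cons-digits t (subst (_< b) (sym h) (s≤s z≤n)) d)
  cons-zero t h (inj₂ l) = inj₂ (inj₂ (h , l))

  cons-≤ : ∀ {n} (t : Vector ℕ (suc n)) → head t ≤ b → Digits (tail t) → Greedy t
  cons-≤ t h d with m≤n⇒m<n∨m≡n h
  ... | inj₁ h<b = inj₁ (cons-digits t h<b d)
  ... | inj₂ h≡b = inj₂ (inj₁ (h≡b , d))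

  lowestB-resp : ∀ {n} {t u : Vector ℕ n} → t ≗ u → LowestB t → LowestB u
  lowestB-resp {suc n} t≗u (inj₁ (h , d)) =
    inj₁ (trans (sym (t≗u zero)) h , λ i → subst (_< b) (t≗u (suc i)) (d i))
  lowestB-resp {suc n} t≗u (inj₂ (h , l)) =
    inj₂ (trans (sym (t≗u zero)) h , lowestB-resp (t≗u ∘ suc) l)

  greedy-resp : ∀ {n} {t u : Vector ℕ n} → t ≗ u → Greedy t → Greedy u
  greedy-resp t≗u (inj₁ d) = inj₁ (λ i → subst (_< b) (t≗u i) (d i))
  greedy-resp t≗u (inj₂ l) = inj₂ (lowestB-resp t≗u l)

  lowestB⇒≤b : ∀ {n} {t : Vector ℕ n} → LowestB t → ∀ i → t i ≤ b
  lowestB⇒≤b {suc n} (inj₁ (h , d)) zero    = ≤-reflexive h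
  lowestB⇒≤b {suc n} (inj₁ (h , d)) (suc i) = <⇒≤ (d i)
  lowestB⇒≤b {suc n} (inj₂ (h , l)) zero    = subst (_≤ b) (sym h) z≤n
  lowestB⇒≤b {suc n} (inj₂ (h , l)) (suc i) = lowestB⇒≤b l i

  greedy⇒≤b : ∀ {n} {t : Vector ℕ n} → Greedy t → ∀ i → t i ≤ b
  greedy⇒≤b (inj₁ d) i = <⇒≤ (d i)
  greedy⇒≤b (inj₂ l) i = lowestB⇒≤b l i

  lowestB⇒zero-before : ∀ {n} {t : Vector ℕ n} → LowestB t →
                         ∀ i → t i ≡ b → ∀ j → ix j < ix i → t j ≡ 0
  lowestB⇒zero-before {suc n} (inj₁ (h , d)) (suc i) e j       j<i = contradiction e (<⇒≢ (d i))
  lowestB⇒zero-before {suc n} (inj₂ (h , l)) (suc i) e zero    j<i = h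
  lowestB⇒zero-before {suc n} (inj₂ (h , l)) (suc i) e (suc j) j<i =
    lowestB⇒zero-before l i e j (s≤s⁻¹ j<i)
  lowestB⇒zero-before {suc n} _              zero    e j       (s≤s ())

  greedy⇒zero-before : ∀ {n} {t : Vector ℕ n} → Greedy t →
                       ∀ i → t i ≡ b → ∀ j → ix j < ix i → t j ≡ 0
  greedy⇒zero-before (inj₁ d) i e = contradiction e (<⇒≢ (d i))
  greedy⇒zero-before (inj₂ l) = lowestB⇒zero-before l

  zero-before⇒greedy : ∀ {n} (t : Vector ℕ n) → (∀ i → t i ≤ b) →
                       (∀ i → t i ≡ b → ∀ j → ix j < ix i → t j ≡ 0) → Greedy t
  zero-before⇒greedy {zero}  t t≤b z = inj₁ λ ()
  zero-before⇒greedy {suc n} t t≤b z with head t ≟ 0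
  ... | yes h≡0 = cons-zero t h≡0
          (zero-before⇒greedy (tail t) (t≤b ∘ suc) λ i e j j<i → z (suc i) e (suc j) (s≤s j<i))
  -- A later coordinate equal to `b` would force the head to be 0.
  ... | no  h≢0 = cons-≤ t (t≤b zero)
          λ i → ≤∧≢⇒< (t≤b (suc i)) λ e → h≢0 (z (suc i) e zero (s≤s (s≤s z≤n)))

  digits-value< : ∀ {m} d (t : Vector ℕ (suc m)) → Digits t → t (fromℕ m) < d → value t < d * b ^ m
  digits-value< {zero}  d t ds l<d =
    subst₂ _<_ (sym (trans (+-identityʳ (head t * 1)) (*-identityʳ (head t)))) (sym (*-identityʳ d)) l<d
  digits-value< {suc m} d t ds l<d = begin-strict
    value t                      ≡⟨ value-∷ t ⟩
    head t + b * value (tail t)  <⟨ +-monoˡ-< _ (ds zero) ⟩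
    b + b * value (tail t)       ≡⟨ *-suc b _ ⟨
    b * suc (value (tail t))     ≤⟨ *-monoʳ-≤ b (digits-value< d (tail t) (ds ∘ suc) l<d) ⟩
    b * (d * b ^ m)              ≡⟨ *-swap b d (b ^ m) ⟩
    d * b ^ suc m                ∎
    where
    open ≤-Reasoning

  -- A head `b` amounts to one more unit in the value of the tail, and the strict digit bound on the
  -- tail leaves room for that unit. A zero head only scales by `b`.
  lowestB-value≤ : ∀ {m} d (t : Vector ℕ (suc m)) → d ≤ b → LowestB t → t (fromℕ m) < d →
                    value t ≤ d * b ^ m
  -- The head is also the last coordinate here, so `b < d ≤ b`.
  lowestB-value≤ {zero}  d t d≤b (inj₁ (h , ds)) l<d =
    contradiction (<-≤-trans l<d d≤b) (<-irrefl h)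
  lowestB-value≤ {suc m} d t d≤b l l<d = begin
    value t                      ≡⟨ value-∷ t ⟩
    head t + b * value (tail t)  ≤⟨ rest l ⟩
    b * (d * b ^ m)              ≡⟨ *-swap b d (b ^ m) ⟩
    d * b ^ suc m                ∎
    where
    open ≤-Reasoning
    rest : LowestB t → head t + b * value (tail t) ≤ b * (d * b ^ m)
    rest (inj₁ (h , ds)) = begin
      head t + b * value (tail t)  ≡⟨ cong (_+ b * value (tail t)) h ⟩
      b + b * value (tail t)       ≡⟨ *-suc b _ ⟨
      b * suc (value (tail t))     ≤⟨ *-monoʳ-≤ b (digits-value< d (tail t) ds l<d) ⟩
      b * (d * b ^ m)              ∎
    rest (inj₂ (h , l′)) = begin
      head t + b * value (tail t)  ≡⟨ cong (_+ b * value (tail t)) h ⟩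
      b * value (tail t)           ≤⟨ *-monoʳ-≤ b (lowestB-value≤ d (tail t) d≤b l′ l<d) ⟩
      b * (d * b ^ m)              ∎

  greedy-value≤ : ∀ {m} d (t : Vector ℕ (suc m)) → d ≤ b → Greedy t → t (fromℕ m) < d →
                  value t ≤ d * b ^ m
  greedy-value≤ d t d≤b (inj₁ ds) l<d = <⇒≤ (digits-value< d t ds l<d)
  greedy-value≤ d t d≤b (inj₂ l)  l<d = lowestB-value≤ d t d≤b l l<d

  greedy-sum≤ : ∀ {m} (t : Vector ℕ (suc m)) → Greedy t → t (fromℕ m) < b → sum t ≤ b ^ suc m
  greedy-sum≤ t gr l<b = ≤-trans (sum≤value t) (greedy-value≤ b t ≤-refl gr l<b)

  only-last : ∀ {m} (t : Vector ℕ (suc m)) → (∀ i → i ≢ fromℕ m → t i ≡ 0) →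
              value t ≡ t (fromℕ m) * b ^ m × sum t ≡ t (fromℕ m)
  only-last {zero}  t z = +-identityʳ _ , +-identityʳ _
  only-last {suc m} t z with only-last (tail t) (λ i i≢ → z (suc i) (i≢ ∘ Fin.suc-injective))
  ... | v , s = trans (value-∷ t) (trans (cong₂ (λ x y → x + b * y) (z zero λ ()) v)
                  (*-swap b (t (fromℕ (suc m))) (b ^ m)))
              , cong₂ _+_ (z zero λ ()) s

  -- As `b ^ 0` and `repunit 1` are both 1, this raises the value and the repunit sum by one, by
  -- computation.
  bump : ∀ {n} → Vector ℕ (suc n) → Vector ℕ (suc n)
  bump t = suc (head t) ∷ tail t

  bump-greedy : ∀ {n} (t : Vector ℕ (suc n)) → Digits t → Greedy (bump t)
  bump-greedy t d = cons-≤ (bump t) (d zero) (d ∘ suc)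

  -- b rᵢ + 1 = rᵢ₊₁ while b bⁱ = bⁱ⁺¹, so trading b units at position i for one unit at
  -- position i + 1 raises the repunit sum by one and keeps the value.
  carry : ∀ {n} (t : Vector ℕ n) → LowestB t →
          value t ≡ b ^ n ⊎
          (∃[ u ] Greedy {n} u × value u ≡ value t × repunits u ≡ suc (repunits t))
  -- The lowest `b` is in the last position: nothing above it can receive the carry.
  carry {suc zero} t (inj₁ (h , d)) =
    inj₁ (trans (+-identityʳ _) (trans (*-identityʳ _) (trans h (sym (*-identityʳ b)))))
  carry {suc (suc n)} t (inj₁ (h , d)) = inj₂ (u , cons-zero u refl (bump-greedy (tail t) d) , same , more)
    where
    u : Vector ℕ (suc (suc n))
    u = 0 ∷ bump (tail t)
    same : value u ≡ value t
    same = trans (value-∷ u) (trans (*-suc b (value (tail t)))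
           (trans (cong (_+ b * value (tail t)) (sym h)) (sym (value-∷ t))))
    more : repunits u ≡ suc (repunits t)
    more = trans (repunits-∷ u) (trans (cong (_+ suc (repunits (tail t))) same)
           (trans (+-suc (value t) _) (cong suc (sym (repunits-∷ t)))))
  carry {suc n} t (inj₂ (h , l)) with carry (tail t) l
  ... | inj₁ v = inj₁ (trans (value-∷ t) (cong₂ (λ x y → x + b * y) h v))
  ... | inj₂ (u , gr , v , r) = inj₂ (0 ∷ u , cons-zero (0 ∷ u) refl gr , same , more)
    where
    same : value (0 ∷ u) ≡ value t
    same = trans (value-∷ (0 ∷ u)) (trans (cong₂ (λ x y → x + b * y) (sym h) v) (sym (value-∷ t)))
    more : repunits (0 ∷ u) ≡ suc (repunits t)
    more = trans (repunits-∷ (0 ∷ u)) (trans (cong₂ _+_ same r)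
           (trans (+-suc (value t) _) (cong suc (sym (repunits-∷ t)))))

  -- Counting up from 0: a vector of digits is bumped, a vector with a lowest `b` is carried.
  greedy-expansion : .{{_ : NonZero a}} → ∀ {m} e → e ≤ b ^ suc m →
                     ∃[ t ] Greedy {suc m} t × repunits t ≡ e
  greedy-expansion {m} zero e≤ = (λ _ → 0) , inj₁ (λ _ → s≤s z≤n) , sum-replicate-zero (suc m)
  greedy-expansion {m} (suc e) e< with greedy-expansion {m} e (<⇒≤ e<)
  ... | t , inj₁ d , refl = bump t , bump-greedy t d , refl
  ... | t , inj₂ l , refl with carry t l
  ...   | inj₂ (u , gr , _ , r) = u , gr , r
  -- A blocked carry has `value t ≡ b ^ suc m`. With `sum t ≤ value t`, the identity `b*value` then
  -- gives `b ^ suc m ≤ repunits t`, so the range is already exhausted.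
  ...   | inj₁ v = contradiction (*-cancelˡ-≤ a (+-cancelˡ-≤ (value t) _ _ full)) (<⇒≱ e<)
    where
    open ≤-Reasoning
    full : value t + a * b ^ suc m ≤ value t + a * repunits t
    full = begin
      value t + a * b ^ suc m     ≡⟨ cong (λ z → value t + a * z) v ⟨
      b * value t                 ≡⟨ b*value t ⟩
      sum t + a * repunits t      ≤⟨ +-monoˡ-≤ _ (sum≤value t) ⟩
      value t + a * repunits t    ∎

  -- Minimality of greedy expansions

  -- The Legendre-type sum of the quotients of `x` by `b`, `b ^ 2`, up to `b ^ N`. The cutoff `N`
  -- makes the recursion structural.
  floors : ℕ → ℕ → ℕ
  floors zero    x = 0
  floors (suc N) x = x / b + floors N (x / b)

  floors-mono : ∀ N {x y} → x ≤ y → floors N x ≤ floors N y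
  floors-mono zero    x≤y = z≤n
  floors-mono (suc N) x≤y = +-mono-≤ (/-monoˡ-≤ b x≤y) (floors-mono N (/-monoˡ-≤ b x≤y))

  floors-monoˡ : ∀ {M N} x → M ≤ N → floors M x ≤ floors N x
  floors-monoˡ x z≤n       = z≤n
  floors-monoˡ x (s≤s M≤N) = +-monoʳ-≤ (x / b) (floors-monoˡ (x / b) M≤N)

  b*m/b≡m : ∀ m → b * m / b ≡ m
  b*m/b≡m m = trans (cong (_/ b) (*-comm b m)) (m*n/n≡m m b)

  /-superadditive : ∀ x y → x / b + y / b ≤ (x + y) / b
  /-superadditive x y = begin
    x / b + y / b            ≡⟨ m*n/n≡m _ b ⟨
    (x / b + y / b) * b / b  ≤⟨ /-monoˡ-≤ b (≤-trans (≤-reflexive (*-distribʳ-+ b (x / b) (y / b)))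
                                  (+-mono-≤ (m/n*n≤m x b) (m/n*n≤m y b))) ⟩
    (x + y) / b              ∎
    where open ≤-Reasoning

  floors-superadditive : ∀ N x y → floors N x + floors N y ≤ floors N (x + y)
  floors-superadditive zero    x y = z≤n
  floors-superadditive (suc N) x y = begin
    (x / b + floors N (x / b)) + (y / b + floors N (y / b))  ≡⟨ interchange (x / b) _ (y / b) _ ⟩
    (x / b + y / b) + (floors N (x / b) + floors N (y / b))
      ≤⟨ +-mono-≤ (/-superadditive x y) (≤-trans (floors-superadditive N (x / b) (y / b)) (floors-mono N (/-superadditive x y))) ⟩
    (x + y) / b + floors N ((x + y) / b)                     ∎
    where
    open ≤-Reasoning
    interchange : ∀ p q r s → (p + q) + (r + s) ≡ (p + r) + (q + s)
    interchange = solve-∀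

  floors-pow : ∀ i → floors i (b ^ i) ≡ repunit i
  floors-pow zero    = refl
  floors-pow (suc i) rewrite b*m/b≡m (b ^ i) = cong (b ^ i +_) (floors-pow i)

  -- `floors` depends on `x` only through `x / b`, which is at most `m` here.
  floors-<-next : ∀ N {x m} → x < b * suc m → floors N x ≤ floors N (b * m)
  floors-<-next zero    x< = z≤n
  floors-<-next (suc N) {x} {m} x< rewrite b*m/b≡m m = +-mono-≤ x/b≤m (floors-mono N x/b≤m)
    where
    x/b≤m : x / b ≤ m
    x/b≤m = s≤s⁻¹ (m<n*o⇒m/o<n (subst (x <_) (*-comm b (suc m)) x<))

  <-cons : ∀ {n} (t : Vector ℕ (suc n)) {x} → head t ≤ b → x < value t → x < b * suc (value (tail t))
  <-cons t {x} h≤b x< = begin-strict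
    x                            <⟨ x< ⟩
    value t                      ≡⟨ value-∷ t ⟩
    head t + b * value (tail t)  ≤⟨ +-monoˡ-≤ _ h≤b ⟩
    b + b * value (tail t)       ≡⟨ *-suc b _ ⟨
    b * suc (value (tail t))     ∎
    where open ≤-Reasoning

  -- For digits, dividing `value t` by `b` drops the head, so the successive quotients of
  -- `b * value t` are the values of `t` and its tails.
  digits-floors : ∀ {n} N (t : Vector ℕ n) → Digits t → floors N (b * value t) ≤ repunits t
  digits-floors zero t d = z≤n
  digits-floors {zero} (suc N) t d rewrite b*m/b≡m 0 =
    ≤-trans (≤-reflexive (cong (floors N) (sym (*-zeroʳ b)))) (digits-floors N t d)
  digits-floors {suc n} (suc N) t d rewrite b*m/b≡m (value t) | repunits-∷ t =
    +-monoʳ-≤ (value t) (≤-trans (floors-<-next N bound) (digits-floors N (tail t) (d ∘ suc)))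
    where
    bound : value t < b * suc (value (tail t))
    bound = subst₂ _<_ (sym (value-∷ t)) (sym (*-suc b _)) (+-monoˡ-< _ (d zero))

  -- Strictness comes from the first quotient, `x / b < value t`. It also handles a head `b`: there
  -- `value t / b` is `value (tail t) + 1`, but the quotient of the smaller `x / b` is at most
  -- `value (tail t)`, so the digit bound applies to the tail.
  greedy-floors< : ∀ {n} N (t : Vector ℕ n) {x} → Greedy t → x < b * value t → floors N x < repunits t
  greedy-floors< {zero} N t {x} gr x< = contradiction (subst (x <_) (*-zeroʳ b) x<) n≮0
  greedy-floors< {suc n} zero t {x} gr x< = ≤-trans positive (≤-trans (m≤m+n _ _) (≤-reflexive (sym (repunits-∷ t))))
    where
    positive : 0 < value t
    positive = n≢0⇒n>0 λ v≡0 → n≮0 (subst (x <_) (trans (cong (b *_) v≡0) (*-zeroʳ b)) x<)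
  greedy-floors< {suc n} (suc N) t {x} gr x< =
    subst (floors (suc N) x <_) (sym (repunits-∷ t)) (+-mono-<-≤ y< (rest gr))
    where
    y< : x / b < value t
    y< = m<n*o⇒m/o<n (subst (x <_) (*-comm b (value t)) x<)
    digits-case : head t ≤ b → Digits (tail t) → floors N (x / b) ≤ repunits (tail t)
    digits-case h≤b d = ≤-trans (floors-<-next N (<-cons t h≤b y<)) (digits-floors N (tail t) d)
    rest : Greedy t → floors N (x / b) ≤ repunits (tail t)
    rest (inj₁ d)              = digits-case (<⇒≤ (d zero)) (d ∘ suc)
    rest (inj₂ (inj₁ (h , d))) = digits-case (≤-reflexive h) d
    rest (inj₂ (inj₂ (h , l))) = <⇒≤ (greedy-floors< N (tail t) (inj₂ l)
      (subst (x / b <_) (trans (value-∷ t) (cong (_+ b * value (tail t)) h)) y<))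

  -- If `k` were below `sum t`, then `b*value` would put `k + a * repunits t` below `b * value t`,
  -- against `greedy-floors<`.
  greedy-minimal : ∀ {n} N (t : Vector ℕ n) k → Greedy t →
                   repunits t ≤ floors N (k + a * repunits t) → sum t ≤ k
  greedy-minimal N t k gr r≤ with sum t ≤? k
  ... | yes s≤k = s≤k
  ... | no  s≰k = contradiction (greedy-floors< N t gr x<) (≤⇒≯ r≤)
    where
    x< : k + a * repunits t < b * value t
    x< = subst (k + a * repunits t <_) (sym (b*value t)) (+-monoˡ-< _ (≰⇒> s≰k))

  -- Semigroup elements through their number of summands and repunit sum.

  -- The individual generators are forgotten: `k` counts them, `e` adds their repunits, and
  -- `k + a * e` is the sum of the matching powers of `b`.
  Represented : ℕ → ℕ → Set
  Represented B s = ∃[ k ] ∃[ e ] ∃[ N ] s ≡ B * (k + a * e) + k × e ≤ floors N (k + a * e)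

  -- A single generator attains equality in the bound, by `floors-pow`; addition preserves the bound
  -- because `floors` is superadditive and grows with the cutoff.
  SC⁺⇒represented : ∀ n {s} → s ∈ SC⁺ b n → Represented (b ^ n) s
  SC⁺⇒represented n (gen (i , refl)) =
    1 , repunit i , i ,
    cong (_+ 1) (trans (^-distribˡ-+-* b n i) (cong (b ^ n *_) (pow≡1+a*repunit i))) ,
    ≤-reflexive (trans (sym (floors-pow i)) (cong (floors i) (pow≡1+a*repunit i)))
  SC⁺⇒represented n zero = 0 , 0 , 0 , sym (trans (+-identityʳ _) (trans (cong (b ^ n *_) (*-zeroʳ a)) (*-zeroʳ (b ^ n)))) , z≤n
  SC⁺⇒represented n (add s∈ s′∈) with SC⁺⇒represented n s∈ | SC⁺⇒represented n s′∈
  ... | k , e , N , refl , e≤ | k′ , e′ , N′ , refl , e′≤ =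
    k + k′ , e + e′ , N ⊔ N′ , identity (b ^ n) a k e k′ e′ , bound
    where
    identity : ∀ B a k e k′ e′ → (B * (k + a * e) + k) + (B * (k′ + a * e′) + k′)
                               ≡ B * ((k + k′) + a * (e + e′)) + (k + k′)
    identity = solve-∀
    regroup : ∀ a k e k′ e′ → (k + a * e) + (k′ + a * e′) ≡ (k + k′) + a * (e + e′)
    regroup = solve-∀
    open ≤-Reasoning
    x = k + a * e
    y = k′ + a * e′
    bound : e + e′ ≤ floors (N ⊔ N′) ((k + k′) + a * (e + e′))
    bound = begin
      e + e′                                   ≤⟨ +-mono-≤ e≤ e′≤ ⟩
      floors N x + floors N′ y                 ≤⟨ +-mono-≤ (floors-monoˡ x (m≤m⊔n N N′)) (floors-monoˡ y (m≤n⊔m N N′)) ⟩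
      floors (N ⊔ N′) x + floors (N ⊔ N′) y    ≤⟨ floors-superadditive (N ⊔ N′) x y ⟩
      floors (N ⊔ N′) (x + y)                  ≡⟨ cong (floors (N ⊔ N′)) (regroup a k e k′ e′) ⟩
      floors (N ⊔ N′) ((k + k′) + a * (e + e′)) ∎

  sum-of-generators : ∀ n (t : Vector ℕ n) →
    sum (λ i → t i * c b n (ix i)) ≡ b ^ n * (sum t + a * repunits t) + sum t
  sum-of-generators n t =
    trans (sum-cong-≗ λ i → trans (cong (λ z → t i * (z + 1)) (^-distribˡ-+-* b n (ix i)))
                                  (expand (t i) (b ^ n) b (b ^ toℕ i)))
    (trans (∑-distrib-+ (λ i → b ^ n * b * (t i * b ^ toℕ i)) t)
           (cong (_+ sum t) (trans (sym (*-distribˡ-sum (b ^ n * b) (λ i → t i * b ^ toℕ i)))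
             (trans (*-assoc (b ^ n) b (value t)) (cong (b ^ n *_) (b*value t))))))
    where
    expand : ∀ x B b p → x * (B * (b * p) + 1) ≡ B * b * (x * p) + x
    expand = solve-∀

  -- Conditions (ii) and (iii) as a bound on the repunit sum

  2≤repunit : ∀ m → 2 ≤ repunit (2 + m)
  2≤repunit m = +-mono-≤ (m^n>0 b (suc m)) (≤-trans (m^n>0 b m) (m≤m+n _ _))

  -- The bound reads `1 + a * R`, with `R` the last repunit. Since `R` is at least 2, a last
  -- coordinate `b` overshoots; a last coordinate `a` leaves at most 1 for any other term, hence
  -- nothing where the repunit is at least 2.
  greedy⇒RC : ∀ {m} (t : Vector (Fin (suc b)) (2 + m)) → Greedy (toℕ ∘ t) →
              repunits (toℕ ∘ t) ≤ b ^ (2 + m) → RC b (2 + m) t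
  greedy⇒RC {m} t gr r≤ = record
    { zero-before = greedy⇒zero-before gr
    ; last-≤ = λ l l≡n → ≮⇒≥ (last≯a l l≡n)
    ; last-≡ = λ l l≡n tl≡a →
        (λ i i≡1 → subst (_≤ 1) (trans (cong (λ z → toℕ (t i) * repunit z) i≡1) (*-identityʳ _))
                     (other≤1 l l≡n tl≡a i λ i≡n → contradiction (trans (sym i≡1) i≡n) λ ()))
      , (λ i i≢1 i≢n → product≤1 (toℕ (t i)) (2≤repunit-ix i i≢1) (other≤1 l l≡n tl≡a i i≢n))
    }
    where
    open ≤-Reasoning
    R = repunit (2 + m)
    x : Vector ℕ (2 + m)
    x i = toℕ (t i) * repunit (ix i)
    total≤ : sum x ≤ 1 + a * R
    total≤ = subst (sum x ≤_) (pow≡1+a*repunit (2 + m)) r≤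
    last≯a : ∀ l → ix l ≡ 2 + m → ¬ a < toℕ (t l)
    last≯a l l≡n a<tl = <⇒≱ (2≤repunit m) (+-cancelʳ-≤ (a * R) R 1 (begin
      b * R                      ≤⟨ *-monoˡ-≤ R a<tl ⟩
      toℕ (t l) * R              ≡⟨ cong (λ z → toℕ (t l) * repunit z) l≡n ⟨
      x l                        ≤⟨ term≤sum x l ⟩
      sum x                      ≤⟨ total≤ ⟩
      1 + a * R                  ∎))
    other≤1 : ∀ l → ix l ≡ 2 + m → toℕ (t l) ≡ a → ∀ i → ix i ≢ 2 + m → x i ≤ 1
    other≤1 l l≡n tl≡a i i≢n = +-cancelʳ-≤ (a * R) (x i) 1 (begin
      x i + a * R  ≡⟨ cong (x i +_) (cong₂ (λ y z → y * repunit z) tl≡a l≡n) ⟨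
      x i + x l    ≤⟨ two-terms≤sum x i l (λ i≡l → i≢n (trans (cong ix i≡l) l≡n)) ⟩
      sum x        ≤⟨ total≤ ⟩
      1 + a * R    ∎)
    2≤repunit-ix : ∀ (i : Fin (2 + m)) → ix i ≢ 1 → 2 ≤ repunit (ix i)
    2≤repunit-ix zero    i≢1 = contradiction refl i≢1
    2≤repunit-ix (suc i) i≢1 = 2≤repunit (toℕ i)
    product≤1 : ∀ y {z} → 2 ≤ z → y * z ≤ 1 → y ≡ 0
    product≤1 zero    2≤z yz≤1 = refl
    product≤1 (suc y) 2≤z yz≤1 = contradiction (≤-trans (m≤m+n _ _) yz≤1) (<⇒≱ 2≤z)

  module _ {m} {t : Vector (Fin (suc b)) (2 + m)} (rc : RC b (2 + m) t) where
    open RC rc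

    private
      u : Vector ℕ (2 + m)
      u = toℕ ∘ t

      l : Fin (2 + m)
      l = fromℕ (suc m)

      l≡n : ix l ≡ 2 + m
      l≡n = cong suc (toℕ-fromℕ (suc m))

    RC⇒greedy : Greedy u
    RC⇒greedy = zero-before⇒greedy u (toℕ≤pred[n] ∘ t) zero-before

    RC⇒sum≤ : sum u ≤ b ^ (2 + m)
    RC⇒sum≤ = greedy-sum≤ u RC⇒greedy (s≤s (last-≤ l l≡n))

    -- If the last coordinate is below `a`, the value is at most `a * b ^ suc m`, and `b*value`
    -- bounds the repunit sum.
    RC⇒repunits≤ : .{{_ : NonZero a}} → repunits u ≤ b ^ (2 + m)
    RC⇒repunits≤ with m≤n⇒m<n∨m≡n (last-≤ l l≡n)
    ... | inj₁ tl<a = *-cancelˡ-≤ a (begin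
      a * repunits u           ≤⟨ m≤n+m _ (sum u) ⟩
      sum u + a * repunits u   ≡⟨ b*value u ⟨
      b * value u              ≤⟨ *-monoʳ-≤ b (greedy-value≤ a u (n≤1+n a) RC⇒greedy tl<a) ⟩
      b * (a * b ^ suc m)      ≡⟨ *-swap b a (b ^ suc m) ⟩
      a * b ^ (2 + m)          ∎)
      where open ≤-Reasoning
    -- Only the head and the last coordinate `a` can be nonzero, so `b * value u` is explicit; a
    -- head equal to 1 gives equality.
    ... | inj₂ tl≡a = *-cancelˡ-≤ a (+-cancelˡ-≤ (head u + a) _ _ (begin
      head u + a + a * repunits u            ≡⟨ cong (λ z → head u + z + a * repunits u) (trans s tl≡a) ⟨
      sum u + a * repunits u                 ≡⟨ b*value u ⟨
      b * value u                            ≡⟨ cong (b *_) (value-∷ u) ⟩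
      b * (head u + b * value (tail u))      ≡⟨ cong (λ z → b * (head u + b * z)) (trans v (cong (_* b ^ m) tl≡a)) ⟩
      b * (head u + b * (a * b ^ m))         ≡⟨ identity a (head u) (b ^ m) ⟩
      head u + a * head u + a * b ^ (2 + m)  ≤⟨ +-monoˡ-≤ _ (+-monoʳ-≤ (head u) (*-monoʳ-≤ a (proj₁ (last-≡ l l≡n tl≡a) zero refl))) ⟩
      head u + a * 1 + a * b ^ (2 + m)       ≡⟨ cong (λ z → head u + z + a * b ^ (2 + m)) (*-identityʳ a) ⟩
      head u + a + a * b ^ (2 + m)           ∎))
      where
      open ≤-Reasoning
      identity : ∀ a h p → suc a * (h + suc a * (a * p)) ≡ h + a * h + a * (suc a * (suc a * p))
      identity = solve-∀
      tail-last = only-last (tail u) λ i i≢l →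
        proj₂ (last-≡ l l≡n tl≡a) (suc i) (λ ()) λ i≡n → i≢l (last-index i (suc-injective i≡n))
      v = proj₁ tail-last
      s = proj₂ tail-last

  -- Arithmetic modulo `c₀`.

  -- As `suc (b ^ n)` is 2 plus a multiple of `a`, a common divisor with `a` divides 2, hence the
  -- even number `b = a + 1`, hence 1.
  coprime-modulus : 2 ∣ b → ∀ n {x} → suc (b ^ n) ∣ b ^ n * a * x → suc (b ^ n) ∣ x
  coprime-modulus 2∣b n {x} p =
    coprime-divisor to-a (coprime-divisor to-B (subst (suc (b ^ n) ∣_) (*-assoc (b ^ n) a x) p))
    where
    to-B : Coprime (suc (b ^ n)) (b ^ n)
    to-B {d} (p , q) = ∣1⇒≡1 (∣m+n∣m⇒∣n (subst (d ∣_) (+-comm 1 (b ^ n)) p) q)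
    to-a : Coprime (suc (b ^ n)) a
    to-a {d} (p , q) = ∣1⇒≡1 (∣m+n∣m⇒∣n (subst (d ∣_) (+-comm 1 a) (∣-trans d∣2 2∣b)) q)
      where
      d∣2 : d ∣ 2
      d∣2 = ∣m+n∣m⇒∣n (subst (d ∣_) (trans (cong suc (pow≡1+a*repunit n)) (+-comm 2 _)) p)
                      (∣m⇒∣m*n (repunit n) q)

  -- With `B = b ^ n`, reduction modulo `B + 1` leaves `B * a * E` against `B * a * e`, so `e` and
  -- `E` differ by a multiple of `B + 1`. The bounds on `K` and `E` force it to be 0.
  same-residue : .{{_ : NonZero a}} → 2 ∣ b → ∀ n {K E k e} → K ≤ b ^ n → E ≤ b ^ n →
                 b ^ n * (K + a * E) + K ≡ (b ^ n * (k + a * e) + k) + suc (b ^ n) →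
                 e ≡ E × K ≡ suc k
  same-residue 2∣b n {K} {E} {k} {e} K≤ E≤ eq with ≤-total E e
  ... | inj₁ E≤e with m≤n⇒∃[o]m+o≡n E≤e
  ...   | x , refl = helper (coprime-modulus 2∣b n (∣m+n∣m⇒∣n
                       (subst (suc B ∣_) reduced (m∣m*n K)) (m∣m*n (suc k)))) reduced
    where
    B = b ^ n
    left : ∀ B a K E → B * (K + a * E) + K ≡ B * a * E + suc B * K
    left = solve-∀
    right : ∀ B a E k x → (B * (k + a * (E + x)) + k) + suc B ≡ B * a * E + (suc B * suc k + B * a * x)
    right = solve-∀
    reduced : suc B * K ≡ suc B * suc k + B * a * x
    reduced = +-cancelˡ-≡ (B * a * E) _ _ (trans (sym (left B a K E)) (trans eq (right B a E k x)))
    collect : ∀ B a k q → suc B * suc k + B * a * (q * suc B) ≡ suc B * (suc k + B * (a * q))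
    collect = solve-∀
    helper : ∀ {x} → suc B ∣ x → suc B * K ≡ suc B * suc k + B * a * x → E + x ≡ E × K ≡ suc k
    helper (divides zero refl) eq′ = +-identityʳ E ,
      *-cancelˡ-≡ _ _ (suc B) (trans eq′ (trans (cong (suc B * suc k +_) (*-zeroʳ (B * a))) (+-identityʳ _)))
    -- An excess of `suc q` moduli in `e` would make `K` equal to `suc k + B * (a * suc q)`, above
    -- `B`.
    helper (divides (suc q) refl) eq′ = contradiction K≤ (<⇒≱ (begin-strict
      B                            <⟨ s≤s (m≤n+m B k) ⟩
      suc k + B                    ≤⟨ +-monoʳ-≤ (suc k) (m≤m*n B (a * suc q) {{m*n≢0 a (suc q)}}) ⟩
      suc k + B * (a * suc q)      ≡⟨ *-cancelˡ-≡ _ _ (suc B) (trans eq′ (collect B a k (suc q))) ⟨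
      K                            ∎))
      where open ≤-Reasoning
  same-residue 2∣b n {K} {E} {k} {e} K≤ E≤ eq | inj₂ e≤E with m≤n⇒∃[o]m+o≡n e≤E
  ...   | x , refl = helper (coprime-modulus 2∣b n (∣m+n∣m⇒∣n
                       (subst (suc B ∣_) (sym reduced) (m∣m*n (suc k))) (m∣m*n K))) reduced (≤-trans (m≤n+m x e) E≤)
    where
    B = b ^ n
    left : ∀ B a K e x → B * (K + a * (e + x)) + K ≡ B * a * e + (suc B * K + B * a * x)
    left = solve-∀
    right : ∀ B a k e → (B * (k + a * e) + k) + suc B ≡ B * a * e + suc B * suc k
    right = solve-∀
    reduced : suc B * K + B * a * x ≡ suc B * suc k
    reduced = +-cancelˡ-≡ (B * a * e) _ _ (trans (sym (left B a K e x)) (trans eq (right B a k e)))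
    helper : ∀ {x} → suc B ∣ x → suc B * K + B * a * x ≡ suc B * suc k → x ≤ B → e ≡ e + x × K ≡ suc k
    helper {zero}  p eq′ x≤B = sym (+-identityʳ e) ,
      *-cancelˡ-≡ _ _ (suc B) (trans (sym (trans (cong (suc B * K +_) (*-zeroʳ (B * a))) (+-identityʳ _))) eq′)
    -- The gap is at most `B`, too small for a nonzero multiple of `B + 1`.
    helper {suc x} p eq′ x≤B = contradiction (≤-trans (∣⇒≤ p) x≤B) 1+n≰n

  -- The two inclusions.

  c₀≡ : ∀ n → c b n 0 ≡ suc (b ^ n)
  c₀≡ n = trans (+-comm _ 1) (cong (λ z → suc (b ^ z)) (+-identityʳ n))

  generators-in : ∀ n (t : Vector ℕ n) → sum (λ i → t i * c b n (ix i)) ∈ SC⁺ b n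
  generators-in n t = sum-in _ λ i → multiple-in (t i) (gen (ix i , refl))

  -- If subtracting `c₀` stayed in the semigroup, `same-residue` would give the same repunit sum
  -- with one summand fewer, against minimality.
  RCSums⊆Ap : .{{_ : NonZero a}} → 2 ∣ b → ∀ m {s} →
              s ∈ RCSums b (2 + m) → s ∈ Ap (SC⁺ b (2 + m)) (c b (2 + m) 0)
  RCSums⊆Ap 2∣b m (t , rc , refl) = generators-in n u , minimal
    where
    n = 2 + m
    u : Vector ℕ n
    u = toℕ ∘ t
    minimal : ¬ (∃[ v ] v ∈ SC⁺ b n × pos (sum λ i → u i * c b n (ix i)) ℤ.- pos (c b n 0) ≡ pos v)
    minimal (v , v∈ , eq) with SC⁺⇒represented n v∈
    ... | k , e , N , v≡ , e≤ with same-residue 2∣b n (RC⇒sum≤ rc) (RC⇒repunits≤ rc)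
            (trans (sym (sum-of-generators n u)) (trans (pos-difference eq) (cong₂ _+_ v≡ (c₀≡ n))))
    ... | refl , K≡ = 1+n≰n (subst (_≤ k) K≡ (greedy-minimal N u k (RC⇒greedy rc) e≤))

  -- Raising the repunit sum by `q * suc B` adds `B * (a * q)` copies of the modulus, and changing
  -- `K` into `k` adds `k - K` copies; `j` is the net count.
  shift-multiples : ∀ B {K E k q j} → K + j ≡ k + B * (a * q) →
    B * (k + a * (E + q * suc B)) + k ≡ (B * (K + a * E) + K) + j * suc B
  shift-multiples B {K} {E} {k} {q} {j} eq =
    trans (split B a k E q) (trans (cong (λ z → suc B * z + B * a * E) (sym eq)) (merge B a K j E))
    where
    split : ∀ B a k E q → B * (k + a * (E + q * suc B)) + k ≡ suc B * (k + B * (a * q)) + B * a * E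
    split = solve-∀
    merge : ∀ B a K j E → suc B * (K + j) + B * a * E ≡ (B * (K + a * E) + K) + j * suc B
    merge = solve-∀

  greedy⇒RCSums : ∀ {m} (u : Vector ℕ (2 + m)) → Greedy u → repunits u ≤ b ^ (2 + m) →
    b ^ (2 + m) * (sum u + a * repunits u) + sum u ∈ RCSums b (2 + m) × sum u ≤ b ^ (2 + m)
  greedy⇒RCSums {m} u gr E≤ =
    (t , rc , trans (sym (sum-of-generators n u)) (sum-cong-≗ λ i → cong (_* c b n (ix i)) (u≗t i))) ,
    subst (_≤ b ^ n) (sym (sum-cong-≗ u≗t)) (RC⇒sum≤ rc)
    where
    n = 2 + m
    t : Vector (Fin (suc b)) n
    t i = fromℕ< (s≤s (greedy⇒≤b gr i))
    u≗t : u ≗ toℕ ∘ t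
    u≗t i = sym (toℕ-fromℕ< _)
    rc : RC b n t
    rc = greedy⇒RC t (greedy-resp u≗t gr)
           (subst (_≤ b ^ n) (sum-cong-≗ λ i → cong (_* repunit (ix i)) (u≗t i)) E≤)

  -- This makes the net count `j` a natural number: `q` zero is minimality, and for positive `q` the
  -- term `B * (a * q)` is already at least `B`.
  sum≤surplus : .{{_ : NonZero a}} → ∀ {n} B N (u : Vector ℕ n) k q → Greedy u → sum u ≤ B →
    repunits u + q * suc B ≤ floors N (k + a * (repunits u + q * suc B)) → sum u ≤ k + B * (a * q)
  sum≤surplus B N u k zero    gr K≤B e≤ = ≤-trans (greedy-minimal N u k gr
    (subst (λ z → z ≤ floors N (k + a * z)) (+-identityʳ _) e≤)) (m≤m+n k _)
  sum≤surplus B N u k (suc q) gr K≤B e≤ =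
    ≤-trans K≤B (≤-trans (m≤m*n B (a * suc q) {{m*n≢0 a (suc q)}}) (m≤n+m _ k))

  -- Dividing the repunit sum by `suc B` leaves a remainder at most `B`, the range covered by
  -- `greedy-expansion`; the quotient is absorbed into copies of `c₀`.
  reduce-modulo-c₀ : .{{_ : NonZero a}} → ∀ m {s} → s ∈ SC⁺ b (2 + m) →
    ∃[ r ] ∃[ j ] r ∈ RCSums b (2 + m) × s ≡ r + j * c b (2 + m) 0
  reduce-modulo-c₀ m {s} s∈ = reduce (SC⁺⇒represented n s∈)
    where
    n = 2 + m
    B = b ^ n
    Goal = ∃[ r ] ∃[ j ] r ∈ RCSums b n × s ≡ r + j * c b n 0

    -- Here `e` is a variable, so its equation can be matched with `refl`.
    combine : ∀ k e N → s ≡ B * (k + a * e) + k → e ≤ floors N (k + a * e) →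
              ∀ (u : Vector ℕ n) q → Greedy u → repunits u ≤ B → e ≡ repunits u + q * suc B → Goal
    combine k e N s≡ e≤ u q gr E≤ refl =
      let r∈ , K≤B = greedy⇒RCSums u gr E≤
          j , eq   = m≤n⇒∃[o]m+o≡n (sum≤surplus B N u k q gr K≤B e≤)
      in _ , j , r∈ ,
         trans s≡ (trans (shift-multiples B eq)
                         (cong (λ z → (B * (sum u + a * repunits u) + sum u) + j * z) (sym (c₀≡ n))))

    reduce : Represented B s → Goal
    reduce (k , e , N , s≡ , e≤) =
      let e%≤B = s≤s⁻¹ (m%n<n e (suc B))
          u , gr , E≡ = greedy-expansion {suc m} (e % suc B) e%≤B
      in combine k e N s≡ e≤ u (e / suc B) gr (subst (_≤ B) (sym E≡) e%≤B)
           (trans (m≡m%n+[m/n]*n e (suc B)) (cong (_+ e / suc B * suc B) (sym E≡)))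

  -- A positive number of copies of `c₀` in the reduction would allow one to be removed inside the
  -- semigroup.
  Ap⊆RCSums : .{{_ : NonZero a}} → ∀ m {s} →
              s ∈ Ap (SC⁺ b (2 + m)) (c b (2 + m) 0) → s ∈ RCSums b (2 + m)
  Ap⊆RCSums m (s∈ , minimal) with reduce-modulo-c₀ m s∈
  ... | r , zero  , r∈ , s≡ = subst (_∈ RCSums b (2 + m)) (sym (trans s≡ (+-identityʳ r))) r∈
  ... | r , suc j , (t , rc , r≡) , s≡ = ⊥-elim (minimal
    ( r + j * c₀
    , add (subst (_∈ SC⁺ b (2 + m)) (sym r≡) (generators-in (2 + m) (toℕ ∘ t)))
          (multiple-in j (gen (0 , refl)))
    , difference-pos (trans s≡ (rotate r c₀ (j * c₀)))))
    where
    c₀ = c b (2 + m) 0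
    rotate : ∀ x y z → x + (y + z) ≡ x + z + y
    rotate = solve-∀

mainTheorem16 : (b n : ℕ) → 2 ≤ b → 2 ∣ b → 2 ≤ n → Ap (SC⁺ b n) (c b n 0) ≐ RCSums b n
mainTheorem16 (suc (suc a)) (suc (suc m)) (s≤s (s≤s _)) 2∣b (s≤s (s≤s _)) =
  Radix.Ap⊆RCSums (suc a) m , Radix.RCSums⊆Ap (suc a) 2∣b m
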